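{- Let $G=(V,E,\omega)$ be a finite directed non-negatively weighted graph, $r\in V$ a root and $k\ge 1$ an integer. Algorithm Exh-S-kSSP (described in the context), run on input $(G,r,k)$, dequeues simple paths from $r$ to any other vertex in non-decreasing order of weight: if a path $\pi$ is dequeued before a path $\pi'$, then $\omega(\pi)\le\omega(\pi')$.
   Context: $G=(V,E,\omega)$ is a finite directed graph, $E\subseteq V\times V$, with non-negative real edge weights $\omega$; $N^+(v)=\{u:(v,u)\in E\}$. A path from $s$ to $t$ is a vertex sequence $P=(s=v_1,\dots,v_\eta=t)$, $\eta\ge 1$, with $(v_i,v_{i+1})\in E$ for all $i<\eta$; $V(P)$ is its vertex set; it is simple if it has no repeated vertex; its weight is $\omega(P)=\sum_{i=1}^{\eta-1}\omega(v_i,v_{i+1})$. For a path $\Pi$ ending at $v$ and an edge $(v,u)$, $\Pi\oplus(u)$ is $\Pi$ extended by $u$. Algorithm Exh-S-kSSP. Maintain a list $T_v$ for each $v\in V$ (initially empty) and a min-priority queue $PQ$ of paths keyed by weight, initially containing only the trivial path $(r)$ with key $0$. While $PQ\ne\emptyset$: remove (dequeue) from $PQ$ a path $\Pi=(r,\dots,v)$ of minimum weight; for each $u\in N^+(v)\setminus V(\Pi)$ insert $\Pi\oplus(u)$ into $PQ$ with key $\omega(\Pi)+\omega(v,u)$; if $|T_v|<k$, add $\Pi$ to $T_v$. -}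

module Defs where

open import Data.Bool.Base using (if_then_else_)
open import Data.Fin.Base using (Fin)
import Data.Fin.Properties as Fin
open import Data.List.Base using (List; []; _∷_; _++_; _∷ʳ_; map; filter; allFin; length)
open import Data.List.NonEmpty.Base as List⁺ using (List⁺; _∷_; _⁺∷ʳ_)
import Data.List.Membership.DecPropositional as DecMembership
open import Data.List.Relation.Binary.Permutation.Propositional using (_↭_)
open import Data.List.Relation.Unary.All using (All)
open import Data.List.Relation.Unary.Linked using (Linked)
open import Data.List.Relation.Unary.Unique.Propositional using (Unique)
open import Data.Nat.Base as ℕ using (ℕ; _⊔_)
import Data.Nat.Properties as ℕ
open import Data.Product.Base using (∃-syntax; _×_; _,_; proj₁; proj₂)
open import Data.Rational.Base as ℚ using (ℚ; 0ℚ; ½)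
import Data.Rational.Properties as ℚ
open import Data.Rational.Solver using (module +-*-Solver)
open import Data.Vec.Functional using (updateAt)
open import Level using (0ℓ)
open import Relation.Binary.Core using (Rel)
open import Relation.Binary.Definitions using (Decidable)
open import Relation.Binary.PropositionalEquality using (_≡_; refl; subst)
open import Relation.Nullary.Decidable using (does; ¬?)

half-pos : ∀ {ε} → 0ℚ ℚ.< ε → 0ℚ ℚ.< ε ℚ.* ½
half-pos 0<ε = ℚ.*-monoˡ-<-pos ½ 0<ε

half+half : ∀ ε → ε ℚ.* ½ ℚ.+ ε ℚ.* ½ ≡ ε
half+half = solve 1 (λ e → e :* con ½ :+ e :* con ½ := e) refl
  where open +-*-Solver

-- Real numbers are Cauchy sequences of rationals. Equality of reals is
-- x ≤ʳ y × y ≤ʳ x, not propositional equality of sequences.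
record ℝ : Set where
  field
    seq    : ℕ → ℚ
    cauchy : ∀ ε → 0ℚ ℚ.< ε →
             ∃[ N ] (∀ m n → N ℕ.≤ m → N ℕ.≤ n → ℚ.∣ seq m ℚ.- seq n ∣ ℚ.≤ ε)

open ℝ public

infix  4 _≤ʳ_
infixl 6 _+ʳ_

_≤ʳ_ : Rel ℝ 0ℓ
x ≤ʳ y = ∀ ε → 0ℚ ℚ.< ε → ∃[ N ] (∀ n → N ℕ.≤ n → seq x n ℚ.≤ seq y n ℚ.+ ε)

0ʳ : ℝ
0ʳ = record
  { seq    = λ _ → 0ℚ
  ; cauchy = λ _ 0<ε → 0 , λ _ _ _ _ → ℚ.<⇒≤ 0<ε
  }

_+ʳ_ : ℝ → ℝ → ℝ
x +ʳ y = record { seq = λ n → seq x n ℚ.+ seq y n ; cauchy = cauchy-+ }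
  where
  rearrange : ∀ a b c d →
              (a ℚ.+ b) ℚ.- (c ℚ.+ d) ≡ (a ℚ.- c) ℚ.+ (b ℚ.- d)
  rearrange = solve 4 (λ a b c d → (a :+ b) :- (c :+ d) := (a :- c) :+ (b :- d)) refl
    where open +-*-Solver

  cauchy-+ : ∀ ε → 0ℚ ℚ.< ε → ∃[ N ] (∀ m n → N ℕ.≤ m → N ℕ.≤ n →
             ℚ.∣ (seq x m ℚ.+ seq y m) ℚ.- (seq x n ℚ.+ seq y n) ∣ ℚ.≤ ε)
  cauchy-+ ε 0<ε
    with N₁ , p ← cauchy x (ε ℚ.* ½) (half-pos 0<ε)
       | N₂ , q ← cauchy y (ε ℚ.* ½) (half-pos 0<ε)
    = N₁ ⊔ N₂ , λ m n N≤m N≤n → begin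
      ℚ.∣ (seq x m ℚ.+ seq y m) ℚ.- (seq x n ℚ.+ seq y n) ∣
        ≡⟨ cong-abs (rearrange (seq x m) (seq y m) (seq x n) (seq y n)) ⟩
      ℚ.∣ (seq x m ℚ.- seq x n) ℚ.+ (seq y m ℚ.- seq y n) ∣
        ≤⟨ ℚ.∣p+q∣≤∣p∣+∣q∣ (seq x m ℚ.- seq x n) (seq y m ℚ.- seq y n) ⟩
      ℚ.∣ seq x m ℚ.- seq x n ∣ ℚ.+ ℚ.∣ seq y m ℚ.- seq y n ∣
        ≤⟨ ℚ.+-mono-≤ (p m n (ℕ.m⊔n≤o⇒m≤o N₁ N₂ N≤m) (ℕ.m⊔n≤o⇒m≤o N₁ N₂ N≤n))
                      (q m n (ℕ.m⊔n≤o⇒n≤o N₁ N₂ N≤m) (ℕ.m⊔n≤o⇒n≤o N₁ N₂ N≤n)) ⟩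
      ε ℚ.* ½ ℚ.+ ε ℚ.* ½
        ≡⟨ half+half ε ⟩
      ε ∎
    where
    open ℚ.≤-Reasoning
    cong-abs : ∀ {a b} → a ≡ b → ℚ.∣ a ∣ ≡ ℚ.∣ b ∣
    cong-abs refl = refl

-- The values of ω on pairs that are not edges are unconstrained and never
-- contribute to the weight of a path.
record Graph : Set₁ where
  field
    order : ℕ

  V : Set
  V = Fin order

  field
    Edge     : Rel V 0ℓ
    edge?    : Decidable Edge
    ω        : V → V → ℝ
    ω-nonneg : ∀ {v u} → Edge v u → 0ʳ ≤ʳ ω v u

  N⁺ : V → List V
  N⁺ v = filter (edge? v) (allFin order)

  VertexSeq : Set
  VertexSeq = List⁺ V

  IsPath : V → V → VertexSeq → Set
  IsPath s t P = List⁺.head P ≡ s × List⁺.last P ≡ t × Linked Edge (List⁺.toList P)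

  IsSimple : VertexSeq → Set
  IsSimple P = Unique (List⁺.toList P)

  weight : VertexSeq → ℝ
  weight (v ∷ vs) = go v vs
    where
    go : V → List V → ℝ
    go v []       = 0ʳ
    go v (u ∷ us) = ω v u +ʳ go u us

  infixl 5 _⊕_

  _⊕_ : VertexSeq → V → VertexSeq
  Π ⊕ u = Π ⁺∷ʳ u

-- The algorithm does not prescribe how ties in the queue are broken (and the
-- order on ℝ is not decidable), so a loop iteration is a relation.
module Exh-S-kSSP (G : Graph) (k : ℕ) where
  open Graph G
  open DecMembership {A = V} Fin._≟_ using (_∈?_)

  record Entry : Set where
    constructor _keyed_
    field
      path : VertexSeq
      key  : ℝ

  open Entry public

  record State : Set where
    constructor ⟨_,_⟩
    field
      T  : V → List VertexSeq
      PQ : List Entry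

  open State public

  initial : V → State
  initial r = ⟨ (λ _ → []) , (List⁺.[ r ] keyed 0ʳ) ∷ [] ⟩

  extensions : VertexSeq → List Entry
  extensions Π =
    map (λ u → (Π ⊕ u) keyed (weight Π +ʳ ω v u))
        (filter (λ u → ¬? (u ∈? List⁺.toList Π)) (N⁺ v))
    where
    v = List⁺.last Π

  record-path : VertexSeq → (V → List VertexSeq) → (V → List VertexSeq)
  record-path Π T =
    updateAt T (List⁺.last Π) (λ Tᵥ → if does (length Tᵥ ℕ.<? k) then Tᵥ ∷ʳ Π else Tᵥ)

  data _⟶⟨_⟩_ (s : State) : VertexSeq → State → Set where
    dequeue : ∀ e rest →
              PQ s ↭ e ∷ rest →
              All (λ e′ → key e ≤ʳ key e′) rest →
              s ⟶⟨ path e ⟩ ⟨ record-path (path e) (T s) , extensions (path e) ++ rest ⟩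

  -- s ⟶*⟨ Πs ⟩ s′: finitely many iterations, not necessarily exhausting the
  -- queue, lead from s to s′ and dequeue the paths Πs in this order.
  data _⟶*⟨_⟩_ (s : State) : List VertexSeq → State → Set where
    stop : s ⟶*⟨ [] ⟩ s
    step : ∀ {Π Πs s′ s″} → s ⟶⟨ Π ⟩ s′ → s′ ⟶*⟨ Πs ⟩ s″ → s ⟶*⟨ Π ∷ Πs ⟩ s″

{-# OPTIONS --safe #-}
-- Every queue entry is keyed by the weight of its path, and edge weights are
-- non-negative, so the extensions inserted after dequeuing a minimal entry have
-- keys at least its key: a lower bound on the keys in the queue remains one
-- forever.
module Submission where

open import Defs
open import Data.Fin.Base using (Fin; zero; suc; _<_)
open import Data.List.Base
  using (List; []; _∷_; _++_; _∷ʳ_; allFin; initLast; _∷ʳ′_; length; lookup)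
open import Data.List.NonEmpty.Base as List⁺ using (_∷_; _⁺∷ʳ_)
open import Data.List.Membership.Propositional using (_∉_)
open import Data.List.Membership.Propositional.Properties using (∈-lookup)
open import Data.List.Relation.Binary.Permutation.Propositional using (↭-sym)
open import Data.List.Relation.Binary.Permutation.Propositional.Properties using (All-resp-↭)
open import Data.List.Relation.Unary.All as All using (All; []; _∷_)
import Data.List.Relation.Unary.All.Properties as All
import Data.List.Relation.Unary.AllPairs as AllPairs
import Data.List.Relation.Unary.AllPairs.Properties as AllPairs
open import Data.List.Relation.Unary.Linked using (Linked; [-]; _∷_)
open import Data.List.Relation.Unary.Unique.Propositional using (Unique)
open import Data.Nat.Base as ℕ using (ℕ; _⊔_; s<s⁻¹)
import Data.Nat.Properties as ℕ
open import Data.Product.Base using (_×_; _,_; ∃-syntax)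
open import Data.Rational.Base as ℚ using (ℚ; 0ℚ; ½)
import Data.Rational.Properties as ℚ
open import Function.Base using (_∘_)
open import Level using (Level)
open import Relation.Binary.Core using (Rel)
open import Relation.Binary.PropositionalEquality
  using (_≡_; _≗_; refl; sym; trans; cong; subst; module ≡-Reasoning)

private
  variable
    a ℓ : Level
    A   : Set a

≤ʳ-reflexive : ∀ {x y} → seq x ≗ seq y → x ≤ʳ y
≤ʳ-reflexive {x} {y} x≗y ε 0<ε = 0 , λ n _ → begin
  seq x n          ≡⟨ x≗y n ⟩
  seq y n          ≡⟨ ℚ.+-identityʳ (seq y n) ⟨
  seq y n ℚ.+ 0ℚ   ≤⟨ ℚ.+-monoʳ-≤ (seq y n) (ℚ.<⇒≤ 0<ε) ⟩
  seq y n ℚ.+ ε    ∎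
  where open ℚ.≤-Reasoning

≤ʳ-refl : ∀ x → x ≤ʳ x
≤ʳ-refl x = ≤ʳ-reflexive {x} {x} (λ _ → refl)

≤ʳ-trans : ∀ {x y z} → x ≤ʳ y → y ≤ʳ z → x ≤ʳ z
≤ʳ-trans {x} {y} {z} x≤y y≤z ε 0<ε
  with N₁ , p ← x≤y (ε ℚ.* ½) (half-pos 0<ε)
     | N₂ , q ← y≤z (ε ℚ.* ½) (half-pos 0<ε)
  = N₁ ⊔ N₂ , λ n N≤n → begin
    seq x n                                  ≤⟨ p n (ℕ.m⊔n≤o⇒m≤o N₁ N₂ N≤n) ⟩
    seq y n ℚ.+ ε ℚ.* ½                      ≤⟨ ℚ.+-monoˡ-≤ (ε ℚ.* ½) (q n (ℕ.m⊔n≤o⇒n≤o N₁ N₂ N≤n)) ⟩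
    seq z n ℚ.+ ε ℚ.* ½ ℚ.+ ε ℚ.* ½          ≡⟨ ℚ.+-assoc (seq z n) (ε ℚ.* ½) (ε ℚ.* ½) ⟩
    seq z n ℚ.+ (ε ℚ.* ½ ℚ.+ ε ℚ.* ½)        ≡⟨ cong (seq z n ℚ.+_) (half+half ε) ⟩
    seq z n ℚ.+ ε                            ∎
  where open ℚ.≤-Reasoning

x≤x+y : ∀ x y → 0ʳ ≤ʳ y → x ≤ʳ x +ʳ y
x≤x+y x y 0≤y ε 0<ε with N , p ← 0≤y ε 0<ε = N , λ n N≤n → begin
  seq x n                        ≡⟨ ℚ.+-identityʳ (seq x n) ⟨
  seq x n ℚ.+ 0ℚ                 ≤⟨ ℚ.+-monoʳ-≤ (seq x n) (p n N≤n) ⟩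
  seq x n ℚ.+ (seq y n ℚ.+ ε)    ≡⟨ ℚ.+-assoc (seq x n) (seq y n) ε ⟨
  seq x n ℚ.+ seq y n ℚ.+ ε      ∎
  where open ℚ.≤-Reasoning

last-∷ : ∀ (x y : A) ys → List⁺.last (x ∷ y ∷ ys) ≡ List⁺.last (y ∷ ys)
last-∷ x y ys with initLast ys
... | []       = refl
... | zs ∷ʳ′ z = refl

Linked-⁺∷ʳ : ∀ {R : Rel A ℓ} xs {y} → Linked R (List⁺.toList xs) →
             R (List⁺.last xs) y → Linked R (List⁺.toList (xs ⁺∷ʳ y))
Linked-⁺∷ʳ (x ∷ [])      [-]         r = r ∷ [-]
Linked-⁺∷ʳ {R = R} (x ∷ x′ ∷ xs) (Rxx′ ∷ Rxs) r =
  Rxx′ ∷ Linked-⁺∷ʳ (x′ ∷ xs) Rxs (subst (λ z → R z _) (last-∷ x x′ xs) r)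

Unique-∷ʳ : ∀ {xs : List A} {y} → Unique xs → y ∉ xs → Unique (xs ∷ʳ y)
Unique-∷ʳ {xs = xs} xs! y∉xs = AllPairs.++⁺ xs! ([] AllPairs.∷ AllPairs.[])
  (All.map (λ y≢x → (y≢x ∘ sym) ∷ []) (All.¬Any⇒All¬ xs y∉xs))

module _ (G : Graph) where
  open Graph G

  -- The local function go of weight is out of scope and has the anchoring
  -- arguments of weight as extra parameters. Unification recovers it here, once
  -- the with abstraction has made all its arguments distinct variables.
  mutual
    seq-go : V → List V → V → List V → ℕ → ℚ
    seq-go = _

    weight-∷ : ∀ v u us n →
               seq (weight (v ∷ u ∷ us)) n ≡ seq (ω v u) n ℚ.+ seq (weight (u ∷ us)) n
    weight-∷ v u us n with u ∷ us
    ... | ws = cong (seq (ω v u) n ℚ.+_) (go-irrelevant v ws u us u us n)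

    go-irrelevant : ∀ v ws u us v′ ws′ → seq-go v ws u us ≗ seq-go v′ ws′ u us
    go-irrelevant v ws u []        v′ ws′ n = refl
    go-irrelevant v ws u (u′ ∷ us) v′ ws′ n =
      cong (seq (ω u u′) n ℚ.+_) (go-irrelevant v ws u′ us v′ ws′ n)

  weight-⊕ : ∀ v vs u → let Π = v ∷ vs in
             seq (weight Π +ʳ ω (List⁺.last Π) u) ≗ seq (weight (Π ⊕ u))
  weight-⊕ v []       u n = ℚ.+-comm 0ℚ (seq (ω v u) n)
  weight-⊕ v (w ∷ ws) u n = begin
    seq (weight (v ∷ w ∷ ws) +ʳ ω (List⁺.last (v ∷ w ∷ ws)) u) n
      ≡⟨ cong (λ l → seq (weight (v ∷ w ∷ ws) +ʳ ω l u) n) (last-∷ v w ws) ⟩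
    seq (weight (v ∷ w ∷ ws) +ʳ ωₗ) n
      ≡⟨ cong (ℚ._+ seq ωₗ n) (weight-∷ v w ws n) ⟩
    seq (ω v w +ʳ weight (w ∷ ws) +ʳ ωₗ) n
      ≡⟨ ℚ.+-assoc (seq (ω v w) n) (seq (weight (w ∷ ws)) n) (seq ωₗ n) ⟩
    seq (ω v w +ʳ (weight (w ∷ ws) +ʳ ωₗ)) n
      ≡⟨ cong (seq (ω v w) n ℚ.+_) (weight-⊕ w ws u n) ⟩
    seq (ω v w +ʳ weight ((w ∷ ws) ⊕ u)) n
      ≡⟨ weight-∷ v w (ws ∷ʳ u) n ⟨
    seq (weight ((v ∷ w ∷ ws) ⊕ u)) n ∎
    where
    open ≡-Reasoning
    ωₗ = ω (List⁺.last (w ∷ ws)) u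

  module _ (k : ℕ) where
    open Exh-S-kSSP G k

    -- Comparing keys pointwise rather than by ≡ spares the type checker the
    -- unfolding of their Cauchy moduli.
    record Extends (Π : VertexSeq) (e : Entry) : Set where
      field
        end   : V
        edge  : Edge (List⁺.last Π) end
        fresh : end ∉ List⁺.toList Π
        path≡ : path e ≡ Π ⊕ end
        key≗  : seq (key e) ≗ seq (weight Π +ʳ ω (List⁺.last Π) end)

    open Extends

    extensions-extend : ∀ Π → All (Extends Π) (extensions Π)
    extensions-extend Π = All.map⁺ (All.map
      (λ (vu , u∉Π) → record
        { edge = vu ; fresh = u∉Π ; path≡ = refl ; key≗ = λ _ → refl })
      (All.zip (All.filter⁺ _ (All.all-filter (edge? _) (allFin order)) ,
                All.all-filter _ (N⁺ _))))

    module _ (r : V) where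

      record Sound (e : Entry) : Set where
        field
          starts : List⁺.head (path e) ≡ r
          linked : Linked Edge (List⁺.toList (path e))
          simple : IsSimple (path e)
          keyed≗ : seq (key e) ≗ seq (weight (path e))

      open Sound

      initial-sound : All Sound (PQ (initial r))
      initial-sound = record
        { starts = refl
        ; linked = [-]
        ; simple = [] AllPairs.∷ AllPairs.[]
        ; keyed≗ = λ _ → refl
        } ∷ []

      extends-sound : ∀ {e e′} → Sound e → Extends (path e) e′ → Sound e′
      extends-sound {Π keyed κ} {_ keyed κ′} se
        record { edge = vu ; fresh = u∉Π ; path≡ = refl ; key≗ = κ′≗ } = record
        { starts = starts se
        ; linked = Linked-⁺∷ʳ Π (linked se) vu
        ; simple = Unique-∷ʳ (simple se) u∉Π
        ; keyed≗ = λ n → trans (κ′≗ n) (weight-⊕ (List⁺.head Π) (List⁺.tail Π) _ n)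
        }

      _≤ᵏ_ : ℝ → Entry → Set
      x ≤ᵏ e = x ≤ʳ key e

      extends-≤ᵏ : ∀ {x e e′} → Sound e → x ≤ᵏ e → Extends (path e) e′ → x ≤ᵏ e′
      extends-≤ᵏ {x} {Π keyed κ} {_ keyed κ′} se x≤κ ext =
        ≤ʳ-trans {x} {κ} {κ′} x≤κ
          (≤ʳ-trans {κ} {weight Π} {κ′} (≤ʳ-reflexive {κ} {weight Π} (keyed≗ se))
            (≤ʳ-trans {weight Π} {weight Π +ʳ w} {κ′} (x≤x+y (weight Π) w (ω-nonneg (edge ext)))
              (≤ʳ-reflexive {weight Π +ʳ w} {κ′} (sym ∘ key≗ ext))))
        where w = ω (List⁺.last Π) (end ext)

      step-sound : ∀ {s Π s′} → s ⟶⟨ Π ⟩ s′ → All Sound (PQ s) → All Sound (PQ s′)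
      step-sound (dequeue e rest PQ↭ _) sound =
        All.++⁺ (All.map (extends-sound (All.head sound′)) (extensions-extend (path e)))
                (All.tail sound′)
        where sound′ = All-resp-↭ PQ↭ sound

      step-≤ᵏ : ∀ {x s Π s′} → s ⟶⟨ Π ⟩ s′ → All Sound (PQ s) →
                All (x ≤ᵏ_) (PQ s) → All (x ≤ᵏ_) (PQ s′)
      step-≤ᵏ {x} (dequeue e rest PQ↭ _) sound x≤ =
        All.++⁺ (All.map (λ {e′} → extends-≤ᵏ {x} {e} {e′} se (All.head x≤′))
                         (extensions-extend (path e)))
                (All.tail x≤′)
        where
        se  = All.head (All-resp-↭ PQ↭ sound)
        x≤′ = All-resp-↭ PQ↭ x≤

      dequeued-simple-path : ∀ {s Π s′} → s ⟶⟨ Π ⟩ s′ → All Sound (PQ s) →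
                             (∃[ t ] IsPath r t Π) × IsSimple Π
      dequeued-simple-path (dequeue e rest PQ↭ _) sound =
        (_ , starts se , refl , linked se) , simple se
        where se = All.head (All-resp-↭ PQ↭ sound)

      ≤-dequeued : ∀ {x s Π s′} → s ⟶⟨ Π ⟩ s′ → All Sound (PQ s) →
                   All (x ≤ᵏ_) (PQ s) → x ≤ʳ weight Π
      ≤-dequeued {x} (dequeue e rest PQ↭ _) sound x≤ =
        ≤ʳ-trans {x} {key e} {weight (path e)} (All.head (All-resp-↭ PQ↭ x≤))
          (≤ʳ-reflexive {key e} {weight (path e)} (keyed≗ (All.head (All-resp-↭ PQ↭ sound))))

      dequeued-≤ᵏ : ∀ {s Π s′} → s ⟶⟨ Π ⟩ s′ → All Sound (PQ s) → All (weight Π ≤ᵏ_) (PQ s)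
      dequeued-≤ᵏ (dequeue e rest PQ↭ e≤rest) sound = All-resp-↭ (↭-sym PQ↭)
        (All.map (λ {e′} → ≤ʳ-trans {weight (path e)} {key e} {key e′} weight≤key)
                 (≤ʳ-refl (key e) ∷ e≤rest))
        where
        weight≤key : weight (path e) ≤ʳ key e
        weight≤key = ≤ʳ-reflexive {weight (path e)} {key e}
          (sym ∘ keyed≗ (All.head (All-resp-↭ PQ↭ sound)))

      all-dequeued-≥ : ∀ {x s s′ Πs} → All Sound (PQ s) → All (x ≤ᵏ_) (PQ s) →
                       s ⟶*⟨ Πs ⟩ s′ → All (λ Π → x ≤ʳ weight Π) Πs
      all-dequeued-≥ _ _ stop = []
      all-dequeued-≥ {x} sound x≤ (step st run) =
        ≤-dequeued {x} st sound x≤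
        ∷ all-dequeued-≥ {x} (step-sound st sound) (step-≤ᵏ {x} st sound x≤) run

      dequeued-simple-paths : ∀ {s s′ Πs} → All Sound (PQ s) → s ⟶*⟨ Πs ⟩ s′ →
                              All (λ π → (∃[ t ] IsPath r t π) × IsSimple π) Πs
      dequeued-simple-paths _ stop = []
      dequeued-simple-paths sound (step st run) =
        dequeued-simple-path st sound ∷ dequeued-simple-paths (step-sound st sound) run

      dequeued-sorted : ∀ {s s′ Πs} → All Sound (PQ s) → s ⟶*⟨ Πs ⟩ s′ →
                        (i j : Fin (length Πs)) → i < j →
                        weight (lookup Πs i) ≤ʳ weight (lookup Πs j)
      dequeued-sorted {Πs = Π ∷ Πs} sound (step st run) zero (suc j) _ =
        All.lookup
          (all-dequeued-≥ {weight Π} (step-sound st sound)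
            (step-≤ᵏ {weight Π} st sound (dequeued-≤ᵏ st sound)) run)
          (∈-lookup j)
      dequeued-sorted sound (step st run) (suc i) (suc j) i<j =
        dequeued-sorted (step-sound st sound) run i j (s<s⁻¹ i<j)

lemma2 : (G : Graph) (r : Graph.V G) (k : ℕ) → 1 ℕ.≤ k →
    let open Graph G
        open Exh-S-kSSP G k
    in (Πs : List VertexSeq) (s : State) → initial r ⟶*⟨ Πs ⟩ s →
       All (λ π → (∃[ t ] IsPath r t π) × IsSimple π) Πs ×
       ((i j : Fin (length Πs)) → i < j →
        weight (lookup Πs i) ≤ʳ weight (lookup Πs j))
lemma2 G r k _ Πs s run =
    dequeued-simple-paths G k r (initial-sound G k r) run
  , dequeued-sorted G k r (initial-sound G k r) run
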